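{- For all $k\geq 1$, $AR_{FF}(P_k) = \frac{k^2}{8}(1+o(1))$, where $P_k$ is the path with $k$ edges and $o(1)$ is a function of $k$ tending to $0$ as $k\to\infty$.
   Context: All graphs are finite and simple. An edge-colored graph is rainbow if all its edges have distinct colors. A copy of $H$ is a (not necessarily induced) subgraph isomorphic to $H$. $AR_{FF}(H)$ (First-Fit anti-Ramsey number): Builder presents vertices and edges of a simple graph, one edge at a time, and each new edge is immediately colored by Painter with the smallest color in $\{1,2,\ldots\}$ not used on an adjacent edge already presented (First-Fit). $AR_{FF}(H)$ is the smallest $t$ such that Builder can present $t$ edges so that the resulting colored graph contains a rainbow copy of $H$. -}

module Defs where

open import Level using (0ℓ)
open import Data.Nat using (ℕ; zero; suc; _≤_)
import Data.Nat.Properties as ℕ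
open import Data.Fin using (Fin; toℕ)
open import Data.List using (List; []; _∷_; length)
open import Data.List.Membership.Propositional using (_∈_)
open import Data.Product using (Σ; ∃; ∃-syntax; _×_; _,_)
open import Data.Sum using (_⊎_; inj₁; inj₂; swap)
open import Data.Rational using (ℚ; 0ℚ; ∣_∣) renaming (_<_ to _<ℚ_)
open import Function.Definitions using (Injective)
open import Relation.Binary.Core using (Rel)
open import Relation.Binary.Definitions using (Symmetric; Irreflexive; Decidable)
open import Relation.Binary.PropositionalEquality using (_≡_; _≢_; refl; sym)
open import Relation.Nullary using (¬_)
open import Relation.Nullary.Decidable using (_⊎-dec_)
open import Relation.Unary using (Pred)

IsLeast : Pred ℕ 0ℓ → ℕ → Set
IsLeast P m = P m × (∀ n → P n → m ≤ n)

record Graph : Set₁ where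
  field
    order     : ℕ
    _~_       : Rel (Fin order) 0ℓ
    ~-sym     : Symmetric _~_
    ~-irrefl  : Irreflexive _≡_ _~_
    _~?_      : Decidable _~_

-- The path with k edges, hence k + 1 vertices.
path : ℕ → Graph
path k = record
  { order    = suc k
  ; _~_      = λ i j → toℕ j ≡ suc (toℕ i) ⊎ toℕ i ≡ suc (toℕ j)
  ; ~-sym    = swap
  ; ~-irrefl = λ { refl (inj₁ e) → ℕ.1+n≢n (sym e)
                 ; refl (inj₂ e) → ℕ.1+n≢n (sym e) }
  ; _~?_     = λ i j → (toℕ j ℕ.≟ suc (toℕ i)) ⊎-dec (toℕ i ℕ.≟ suc (toℕ j))
  }

-- A coloured graph on the vertex set Fin n, as the list of its edges, most
-- recently presented first. An edge {u , v} of colour c occurs as (u , v , c)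
-- or as (v , u , c), the order of the endpoints having no meaning.
ColouredGraph : ℕ → Set
ColouredGraph n = List (Fin n × Fin n × ℕ)

module _ {n : ℕ} where

  HasEdge : ColouredGraph n → Fin n → Fin n → ℕ → Set
  HasEdge G u v c = (u , v , c) ∈ G ⊎ (v , u , c) ∈ G

  Adjacent : ColouredGraph n → Fin n → Fin n → Set
  Adjacent G u v = ∃[ c ] HasEdge G u v c

  ColourAt : ColouredGraph n → Fin n → ℕ → Set
  ColourAt G w c = ∃[ x ] HasEdge G w x c

  Available : ColouredGraph n → Fin n → Fin n → ℕ → Set
  Available G u v c = 1 ≤ c × ¬ ColourAt G u c × ¬ ColourAt G v c

  -- The coloured graphs that can arise when Painter plays First-Fit. Isolated
  -- vertices never affect the colouring, so all n vertices are taken to be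
  -- present from the start.
  data FirstFitPlay : ColouredGraph n → Set where
    start   : FirstFitPlay []
    present : ∀ {G u v c} → FirstFitPlay G →
              u ≢ v → ¬ Adjacent G u v →
              IsLeast (Available G u v) c →
              FirstFitPlay ((u , v , c) ∷ G)

  module _ (H : Graph) (G : ColouredGraph n) where
    open Graph H

    IsCopy : (Fin order → Fin n) → Set
    IsCopy f = Injective _≡_ _≡_ f × (∀ i j → i ~ j → Adjacent G (f i) (f j))

    -- Edges of the copy sharing a colour are the same unordered pair.
    IsRainbow : (Fin order → Fin n) → Set
    IsRainbow f = ∀ i j i′ j′ c → i ~ j → i′ ~ j′ →
                  HasEdge G (f i) (f j) c → HasEdge G (f i′) (f j′) c →
                  (i ≡ i′ × j ≡ j′) ⊎ (i ≡ j′ × j ≡ i′)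

    HasRainbowCopy : Set
    HasRainbowCopy = ∃[ f ] IsCopy f × IsRainbow f

Forces : Graph → ℕ → Set
Forces H t = Σ ℕ λ n → Σ (ColouredGraph n) λ G →
             FirstFitPlay G × length G ≡ t × HasRainbowCopy H G

-- t is the First-Fit anti-Ramsey number of H.
IsAR-FF : Graph → ℕ → Set
IsAR-FF H = IsLeast (Forces H)

TendsToZero : (ℕ → ℚ) → Set
TendsToZero o = ∀ ε → 0ℚ <ℚ ε → ∃[ N ] (∀ k → N ≤ k → ∣ o k ∣ <ℚ ε)

{-# OPTIONS --safe #-}
module Submission where

-- Lower bound. Under First-Fit an edge uv of colour c has all colours up to c at u or v, so
-- c ≤ deg u + deg v. Along a rainbow path the colours add up to at least k(k+1)/2, the right-hand
-- sides to at most twice the degree sum of the path's vertices, which is at most 2t. Hence k² ≤ 8t.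
--
-- Upper bound. Any proper colouring in which every edge of colour c meets edges of all smaller
-- colours can be played. Let N = 4B + 4 and join the vertices x, v < 4B + 3 in colour x + v − N ≥ 1
-- whenever x is even and v + 3 ≤ x. The larger, even endpoint of such an edge sees every smaller
-- colour by itself. Six helping vertices supply even vertices x with the colours 2x − N − 2, …,
-- 2x − N + 3; then {y, y+1} together see every colour below y but not y, so the path 1, 2, …, k + 1
-- gets the colours 1, …, k. With B ≈ k/4 this takes k²/8 + O(k) edges.
--
-- The minimum exists constructively because Forces is decidable: t edges touch at most 2t vertices.

open import Defs
open import Data.Nat using (ℕ; suc; _≤_; _^_)
open import Data.Rational using (ℚ)
open import Data.Product using (Σ; ∃; ∃-syntax; _×_; _,_; proj₁; proj₂)
open import Data.Product.Properties using (≡-dec)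
open import Data.Sum using (_⊎_; inj₁; inj₂; [_,_]′)
import Data.Sum as Sum
open import Data.Empty using (⊥; ⊥-elim)
open import Data.Fin using (Fin; toℕ; fromℕ<; inject₁; punchIn; zero) renaming (suc to fsuc)
import Data.Fin.Properties as Fin
open import Data.List using (List; []; _∷_; length; map; _++_; lookup)
open import Data.List.Properties using (length-++; length-map)
open import Data.List.Membership.Propositional using (_∈_)
open import Data.List.Membership.Propositional.Properties using (∈-++⁺ˡ; ∈-++⁺ʳ; ∈-map⁺; ∈-map⁻)
open import Data.List.Relation.Unary.Any using (here; there; index; any?)
open import Data.List.Relation.Unary.Any.Properties using (lookup-index)
open import Data.Vec.Functional using (removeAt)
import Data.Vec.Functional as Vector
open import Function using (_∘_; id)
open import Function.Definitions using (Injective)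
open import Relation.Nullary using (¬_; Dec; yes; no)
open import Relation.Nullary.Decidable using (_⊎-dec_; _×-dec_; _→-dec_; ¬?; map′; decidable-stable)
open import Relation.Unary using (Pred; Decidable)
open import Relation.Binary.PropositionalEquality

module _ where

  open import Data.Nat hiding (_/_; parity)
  open import Data.Nat.Properties
  open import Data.Nat.DivMod using (_%_; m%n<n; m<n⇒m%n≡m; m≡m%n+[m/n]*n)
  import Data.Nat.DivMod as ℕ
  open import Data.Nat.Induction using (<-rec)
  open import Data.Nat.Tactic.RingSolver using (solve)
  import Data.Integer as ℤ
  import Data.Integer.Properties as ℤ
  open import Data.Rational using (mkℚ; 0ℚ; 1ℚ; toℚᵘ; ↧ₙ_)
    renaming (_/_ to _/ℚ_; _+_ to _+ℚ_; _*_ to _*ℚ_; ∣_∣ to ∣_∣ℚ; _<_ to _<ℚ_)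
  import Data.Rational.Base as ℚ
  import Data.Rational.Properties as ℚ
  open import Data.Rational.Unnormalised using (mkℚᵘ; *≡*; *<*; _≃_)
  import Data.Rational.Unnormalised as ℚᵘ
  import Data.Rational.Unnormalised.Properties as ℚᵘ
  open import Algebra.Properties.CommutativeMonoid.Sum +-0-commutativeMonoid
    using (sum; sum-remove; ∑-distrib-+; sum-init-last; sum-cong-≗; sum-replicate-zero)

  -- Playing towards a prescribed colouring

  least : ∀ {P : Pred ℕ _} → Decidable P → ∀ n → P n → ∃ (IsLeast P)
  least {P} P? = <-rec _ step
    where
    step : ∀ n → (∀ {m} → m < n → P m → ∃ (IsLeast P)) → P n → ∃ (IsLeast P)
    step n rec Pn with anyUpTo? P? n
    ... | yes (m , m<n , Pm) = rec m<n Pm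
    ... | no none = n , Pn , λ m Pm → ≮⇒≥ (λ m<n → none (m , m<n , Pm))

  least-unique : ∀ {P : Pred ℕ _} {m n} → IsLeast P m → IsLeast P n → m ≡ n
  least-unique (Pm , m≤) (Pn , n≤) = ≤-antisym (m≤ _ Pn) (n≤ _ Pm)

  module _ {n : ℕ} where

    _∈?_ : (e : Fin n × Fin n × ℕ) (G : ColouredGraph n) → Dec (e ∈ G)
    e ∈? G = any? (≡-dec Fin._≟_ (≡-dec Fin._≟_ _≟_) e) G

    HasEdge? : ∀ (G : ColouredGraph n) u v c → Dec (HasEdge G u v c)
    HasEdge? G u v c = ((u , v , c) ∈? G) ⊎-dec ((v , u , c) ∈? G)

    maxColour : ColouredGraph n → ℕ
    maxColour []                = 0
    maxColour ((_ , _ , c) ∷ G) = c ⊔ maxColour G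

    ∈⇒≤maxColour : ∀ {G : ColouredGraph n} {u v c} → (u , v , c) ∈ G → c ≤ maxColour G
    ∈⇒≤maxColour {(_ , _ , c) ∷ G} (here refl) = m≤m⊔n c (maxColour G)
    ∈⇒≤maxColour {(_ , _ , c) ∷ G} (there e)   = ≤-trans (∈⇒≤maxColour e) (m≤n⊔m c (maxColour G))

    HasEdge⇒≤maxColour : ∀ {G : ColouredGraph n} {u v c} → HasEdge G u v c → c ≤ maxColour G
    HasEdge⇒≤maxColour = [ ∈⇒≤maxColour , ∈⇒≤maxColour ]′

    ColourAt? : ∀ (G : ColouredGraph n) w c → Dec (ColourAt G w c)
    ColourAt? G w c = Fin.any? (λ x → HasEdge? G w x c)

    Adjacent? : ∀ (G : ColouredGraph n) u v → Dec (Adjacent G u v)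
    Adjacent? G u v = map′ (λ (c , _ , e) → c , e)
                           (λ (c , e) → c , s≤s (HasEdge⇒≤maxColour e) , e)
                           (anyUpTo? (HasEdge? G u v) (suc (maxColour G)))

    Available? : ∀ (G : ColouredGraph n) u v → Decidable (Available G u v)
    Available? G u v c = (1 ≤? c) ×-dec (¬? (ColourAt? G u c) ×-dec ¬? (ColourAt? G v c))

    least-available : ∀ (G : ColouredGraph n) u v → ∃ (IsLeast (Available G u v))
    least-available G u v = least (Available? G u v) (suc (maxColour G)) (s≤s z≤n , fresh , fresh)
      where
      fresh : ∀ {w} → ¬ ColourAt G w (suc (maxColour G))
      fresh (_ , e) = 1+n≰n (HasEdge⇒≤maxColour e)

    HasEdge-∷ : ∀ {G : ColouredGraph n} {e u v c} → HasEdge G u v c → HasEdge (e ∷ G) u v c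
    HasEdge-∷ = Sum.map there there

    HasEdge-sym : ∀ {G : ColouredGraph n} {u v c} → HasEdge G u v c → HasEdge G v u c
    HasEdge-sym = Sum.swap

    Sees : ColouredGraph n → Fin n → Fin n → ℕ → Set
    Sees G u v c = ColourAt G u c ⊎ ColourAt G v c

    -- Minimality blocked each smaller colour at an end when the edge was presented, and later edges
    -- only add colours. Decidability makes the disjunction explicit.
    sees-smaller : ∀ {G : ColouredGraph n} {u v c} → FirstFitPlay G → HasEdge G u v c →
                   ∀ {c′} → 1 ≤ c′ → c′ < c → Sees G u v c′
    sees-smaller (present play _ _ least) (inj₁ (here refl)) 1≤c′ c′<c =
      Sum.map (λ (x , e) → x , HasEdge-∷ e) (λ (x , e) → x , HasEdge-∷ e) (new least 1≤c′ c′<c)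
      where
      new : ∀ {G u v c c′} → IsLeast (Available G u v) c → 1 ≤ c′ → c′ < c → Sees G u v c′
      new {G} {u} {v} {c′ = c′} (_ , minimal) 1≤c′ c′<c =
        decidable-stable (ColourAt? G u c′ ⊎-dec ColourAt? G v c′)
          (λ none → <⇒≱ c′<c (minimal c′ (1≤c′ , none ∘ inj₁ , none ∘ inj₂)))
    sees-smaller play@(present _ _ _ _) (inj₂ (here refl)) 1≤c′ c′<c =
      Sum.swap (sees-smaller play (inj₁ (here refl)) 1≤c′ c′<c)
    sees-smaller (present play _ _ _) (inj₁ (there e)) 1≤c′ c′<c =
      Sum.map (λ (x , e) → x , HasEdge-∷ e) (λ (x , e) → x , HasEdge-∷ e)
        (sees-smaller play (inj₁ e) 1≤c′ c′<c)
    sees-smaller (present play _ _ _) (inj₂ (there e)) 1≤c′ c′<c =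
      Sum.map (λ (x , e) → x , HasEdge-∷ e) (λ (x , e) → x , HasEdge-∷ e)
        (sees-smaller play (inj₂ e) 1≤c′ c′<c)

  Meet : ∀ {A : Set} → A → A → A → A → Set
  Meet u v u′ v′ = (u ≡ u′ ⊎ u ≡ v′) ⊎ (v ≡ u′ ⊎ v ≡ v′)

  SamePair : ∀ {A : Set} → A → A → A → A → Set
  SamePair u v u′ v′ = (u ≡ u′ × v ≡ v′) ⊎ (u ≡ v′ × v ≡ u′)

  -- A properly coloured simple graph for Builder to aim at, each edge in one orientation only.
  record Target (A : Set) : Set₁ where
    field
      Edge    : A → A → ℕ → Set
      irrefl  : ∀ {u v c} → Edge u v c → u ≢ v
      proper  : ∀ {u v u′ v′ c} → Edge u v c → Edge u′ v′ c → Meet u v u′ v′ → u ≡ u′ × v ≡ v′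
      simple  : ∀ {u v u′ v′ c c′} → Edge u v c → Edge u′ v′ c′ → SamePair u v u′ v′ → c ≡ c′

  module Playing {n : ℕ} (T : Target (Fin n)) where
    open Target T

    record Stage : Set where
      field
        graph : ColouredGraph n
        play  : FirstFitPlay graph
        sound : ∀ {u v c} → (u , v , c) ∈ graph → Edge u v c
    open Stage public

    -- The cost `d` is only an upper bound, as an edge already present costs nothing.
    _⊑[_]_ : Stage → ℕ → Stage → Set
    S ⊑[ d ] S′ = (∀ {e} → e ∈ graph S → e ∈ graph S′) × length (graph S′) ≤ d + length (graph S)

    ⊑-trans : ∀ {S S′ S″ d d′} → S ⊑[ d ] S′ → S′ ⊑[ d′ ] S″ → S ⊑[ d′ + d ] S″
    ⊑-trans {d = d} {d′} (i , l) (i′ , l′) =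
      i′ ∘ i , ≤-trans l′ (≤-trans (+-monoʳ-≤ d′ l) (≤-reflexive (sym (+-assoc d′ d _))))

    -- All presented edges are target edges, so properness keeps `c` free at both ends. With the
    -- smaller colours seen, First-Fit has to choose `c`.
    extend : ∀ S {u v c} → Edge u v c → 1 ≤ c →
             (∀ {c′} → 1 ≤ c′ → c′ < c → Sees (graph S) u v c′) →
             ∃[ S′ ] S ⊑[ 1 ] S′ × (u , v , c) ∈ graph S′
    extend S {u} {v} {c} e 1≤c lower with (u , v , c) ∈? graph S
    ... | yes e∈ = S , (id , n≤1+n _) , e∈
    ... | no  e∉ = record { graph = (u , v , c) ∷ graph S
                          ; play  = present (play S) (irrefl e) nonadjacent available
                          ; sound = λ { (here refl) → e ; (there i) → sound S i } }
                 , (there , ≤-refl) , here refl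
      where
      nonadjacent : ¬ Adjacent (graph S) u v
      nonadjacent (c′ , inj₁ i) with refl ← simple e (sound S i) (inj₁ (refl , refl)) = e∉ i
      -- A reversed copy of the edge would, by properness, force `u ≡ v`.
      nonadjacent (c′ , inj₂ i) with refl ← simple e (sound S i) (inj₂ (refl , refl)) =
        irrefl e (proj₁ (proper e (sound S i) (inj₁ (inj₂ refl))))

      free-u : ¬ ColourAt (graph S) u c
      free-u (x , inj₁ i) with refl , refl ← proper e (sound S i) (inj₁ (inj₁ refl)) = e∉ i
      free-u (x , inj₂ i) with refl , refl ← proper e (sound S i) (inj₁ (inj₂ refl)) = irrefl e refl

      free-v : ¬ ColourAt (graph S) v c
      free-v (x , inj₁ i) with refl , refl ← proper e (sound S i) (inj₂ (inj₁ refl)) = irrefl e refl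
      free-v (x , inj₂ i) with refl , refl ← proper e (sound S i) (inj₂ (inj₂ refl)) = e∉ i

      available : IsLeast (Available (graph S) u v) c
      available = (1≤c , free-u , free-v) ,
        λ m (1≤m , m∉u , m∉v) → ≮⇒≥ (λ m<c → [ m∉u , m∉v ]′ (lower 1≤m m<c))

  -- Lower bound

  sum-mono : ∀ {k} {f g : Fin k → ℕ} → (∀ i → f i ≤ g i) → sum f ≤ sum g
  sum-mono {zero}  h = z≤n
  sum-mono {suc k} h = +-mono-≤ (h zero) (sum-mono (h ∘ fsuc))

  -- k distinct positive integers: the largest is at least k, and the others are again distinct.
  triangle : ∀ {k} (f : Fin k → ℕ) → Injective _≡_ _≡_ f → (∀ i → 1 ≤ f i) → k * suc k ≤ 2 * sum f
  triangle {zero} f inj pos = z≤n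
  triangle {suc k} f inj pos with Fin.any? (λ i → suc k ≤? f i)
  ... | yes (i , big) = ≤-trans (≤-reflexive (split k)) (≤-trans
          (+-mono-≤ (*-monoʳ-≤ 2 big) (triangle (removeAt f i) (Fin.punchIn-injective i _ _ ∘ inj)
            (λ j → pos (punchIn i j))))
          (≤-reflexive (trans (sym (*-distribˡ-+ 2 (f i) _)) (cong (2 *_) (sym (sum-remove {i = i} f))))))
    where
    split : ∀ k → suc k * suc (suc k) ≡ 2 * suc k + k * suc k
    split k = solve (k ∷ [])
  -- Otherwise subtracting one would inject `k + 1` indices into `k` places.
  ... | no small = ⊥-elim (Fin.<⇒notInjective (n<1+n k) shift-injective)
    where
    pred< : ∀ i → pred (f i) < k
    pred< i = ≤-trans (≤-reflexive (suc-pred (f i) ⦃ >-nonZero (pos i) ⦄))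
      (s≤s⁻¹ (≰⇒> (λ b → small (i , b))))
    shift : Fin (suc k) → Fin k
    shift i = fromℕ< (pred< i)
    shift-injective : Injective _≡_ _≡_ shift
    shift-injective {i} {j} eq = inj (pred-injective ⦃ >-nonZero (pos i) ⦄ ⦃ >-nonZero (pos j) ⦄
      (Fin.fromℕ<-injective _ _ (pred< i) (pred< j) eq))

  -- Each colour picks a position in the list, injectively; repetitions in the list do no harm.
  colours-bound : ∀ (xs : List ℕ) m → (∀ {c} → 1 ≤ c → c ≤ m → c ∈ xs) → m ≤ length xs
  colours-bound xs m all = Fin.injective⇒≤ {f = position} position-injective
    where
    member : ∀ i → suc (toℕ i) ∈ xs
    member i = all (s≤s z≤n) (Fin.toℕ<n i)
    position : Fin m → Fin (length xs)
    position i = index (member i)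
    position-injective : Injective _≡_ _≡_ position
    position-injective {i} {j} eq = Fin.toℕ-injective (suc-injective
      (trans (lookup-index (member i)) (trans (cong (lookup xs) eq) (sym (lookup-index (member j))))))

  module _ {n : ℕ} where

    indicator : Fin n → Fin n → ℕ
    indicator u w with u Fin.≟ w
    ... | yes _ = 1
    ... | no _  = 0

    endColours : Fin n → Fin n → ℕ → List ℕ
    endColours u w c with u Fin.≟ w
    ... | yes _ = c ∷ []
    ... | no _  = []

    length-endColours : ∀ u w c → length (endColours u w c) ≡ indicator u w
    length-endColours u w c with u Fin.≟ w
    ... | yes _ = refl
    ... | no _  = refl

    ∈-endColours : ∀ w c → c ∈ endColours w w c
    ∈-endColours w c with w Fin.≟ w
    ... | yes _ = here refl
    ... | no w≢w = ⊥-elim (w≢w refl)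

    coloursAt : ColouredGraph n → Fin n → List ℕ
    coloursAt [] w = []
    coloursAt ((u , v , c) ∷ G) w = endColours u w c ++ endColours v w c ++ coloursAt G w

    degree : ColouredGraph n → Fin n → ℕ
    degree [] w = 0
    degree ((u , v , _) ∷ G) w = indicator u w + (indicator v w + degree G w)

    length-coloursAt : ∀ G w → length (coloursAt G w) ≡ degree G w
    length-coloursAt [] w = refl
    length-coloursAt ((u , v , c) ∷ G) w = trans (length-++ (endColours u w c))
      (cong₂ _+_ (length-endColours u w c) (trans (length-++ (endColours v w c))
        (cong₂ _+_ (length-endColours v w c) (length-coloursAt G w))))

    ∈-coloursAt : ∀ {G : ColouredGraph n} {w c} → ColourAt G w c → c ∈ coloursAt G w
    ∈-coloursAt {(_ , _ , c) ∷ G} {w} (x , inj₁ (here refl)) = ∈-++⁺ˡ (∈-endColours w c)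
    ∈-coloursAt {(u , _ , c) ∷ G} {w} (x , inj₂ (here refl)) =
      ∈-++⁺ʳ (endColours u w c) (∈-++⁺ˡ (∈-endColours w c))
    ∈-coloursAt {(u , v , c) ∷ G} {w} (x , inj₁ (there e)) =
      ∈-++⁺ʳ (endColours u w c) (∈-++⁺ʳ (endColours v w c) (∈-coloursAt (x , inj₁ e)))
    ∈-coloursAt {(u , v , c) ∷ G} {w} (x , inj₂ (there e)) =
      ∈-++⁺ʳ (endColours u w c) (∈-++⁺ʳ (endColours v w c) (∈-coloursAt (x , inj₂ e)))

    -- `c` lies on the edge itself, and First-Fit puts the smaller colours at `u` or `v`.
    colour≤degrees : ∀ {G : ColouredGraph n} {u v c} → FirstFitPlay G → HasEdge G u v c →
      c ≤ degree G u + degree G v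
    colour≤degrees {G} {u} {v} {c} play e = ≤-trans
      (colours-bound (coloursAt G u ++ coloursAt G v) c all)
      (≤-reflexive (trans (length-++ (coloursAt G u))
        (cong₂ _+_ (length-coloursAt G u) (length-coloursAt G v))))
      where
      all : ∀ {c′} → 1 ≤ c′ → c′ ≤ c → c′ ∈ coloursAt G u ++ coloursAt G v
      all 1≤c′ c′≤c with m≤n⇒m<n∨m≡n c′≤c
      ... | inj₂ refl = ∈-++⁺ˡ (∈-coloursAt (v , e))
      ... | inj₁ c′<c with sees-smaller play e 1≤c′ c′<c
      ...   | inj₁ a = ∈-++⁺ˡ (∈-coloursAt a)
      ...   | inj₂ a = ∈-++⁺ʳ (coloursAt G u) (∈-coloursAt a)

    positive-colour : ∀ {G : ColouredGraph n} {u v c} → FirstFitPlay G → HasEdge G u v c → 1 ≤ c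
    positive-colour (present _ _ _ ((1≤c , _) , _)) (inj₁ (here refl)) = 1≤c
    positive-colour (present _ _ _ ((1≤c , _) , _)) (inj₂ (here refl)) = 1≤c
    positive-colour (present play _ _ _) (inj₁ (there e)) = positive-colour play (inj₁ e)
    positive-colour (present play _ _ _) (inj₂ (there e)) = positive-colour play (inj₂ e)

    indicator-≢ : ∀ {u w} → u ≢ w → indicator u w ≡ 0
    indicator-≢ {u} {w} u≢w with u Fin.≟ w
    ... | yes eq = ⊥-elim (u≢w eq)
    ... | no _   = refl

    sum-zero : ∀ {m} (f : Fin m → ℕ) → (∀ i → f i ≡ 0) → sum f ≡ 0
    sum-zero {m} f h = trans (sum-cong-≗ h) (sum-replicate-zero m)

    sum-indicator≤1 : ∀ {m} (f : Fin m → Fin n) → Injective _≡_ _≡_ f → ∀ u → sum (indicator u ∘ f) ≤ 1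
    sum-indicator≤1 {zero} f inj u = z≤n
    sum-indicator≤1 {suc m} f inj u with u Fin.≟ f zero
    ... | yes refl = ≤-reflexive (cong suc
        (sum-zero (indicator (f zero) ∘ f ∘ fsuc) λ i → indicator-≢ (λ eq → Fin.0≢1+n (inj eq))))
    ... | no _     = sum-indicator≤1 (f ∘ fsuc) (Fin.suc-injective ∘ inj) u

    -- Being injective, `f` meets each end of an edge at most once, so an edge adds at most two.
    handshake : ∀ {m} (f : Fin m → Fin n) → Injective _≡_ _≡_ f → ∀ G → sum (degree G ∘ f) ≤ 2 * length G
    handshake f inj [] = ≤-reflexive (sum-zero (degree [] ∘ f) λ _ → refl)
    handshake f inj ((u , v , _) ∷ G) = ≤-trans
      (≤-reflexive (trans (∑-distrib-+ (indicator u ∘ f) _)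
        (cong (sum (indicator u ∘ f) +_) (∑-distrib-+ (indicator v ∘ f) _))))
      (≤-trans (+-mono-≤ (sum-indicator≤1 f inj u) (+-mono-≤ (sum-indicator≤1 f inj v) (handshake f inj G)))
        (≤-reflexive (sym (*-suc 2 (length G)))))

  -- A vertex of the path lies in at most two consecutive pairs.
  sum-consecutive : ∀ {k} (g : Fin (suc k) → ℕ) →
    sum (λ (i : Fin k) → g (inject₁ i) + g (fsuc i)) ≤ 2 * sum g
  sum-consecutive {k} g = ≤-trans (≤-reflexive (∑-distrib-+ (g ∘ inject₁) (g ∘ fsuc)))
    (≤-trans (+-mono-≤ (≤-trans (m≤m+n _ _) (≤-reflexive (sym (sum-init-last g))))
      (m≤n+m (sum (g ∘ fsuc)) (g zero)))
      (≤-reflexive (cong (sum g +_) (sym (+-identityʳ (sum g))))))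

  -- The three factors of two come from the triangular number, the two path edges at a vertex, and
  -- the two ends of a presented edge.
  lower-bound : ∀ {k t} → Forces (path k) t → k * suc k ≤ 8 * t
  lower-bound {k} (n , G , play , refl , f , (inj , copy) , rainbow) = begin
    k * suc k                               ≤⟨ triangle colour colour-injective positive ⟩
    2 * sum colour                          ≤⟨ *-monoʳ-≤ 2 (sum-mono λ i → colour≤degrees play (edge i)) ⟩
    2 * sum (λ i → deg (inject₁ i) + deg (fsuc i)) ≤⟨ *-monoʳ-≤ 2 (sum-consecutive deg) ⟩
    2 * (2 * sum deg)                       ≤⟨ *-monoʳ-≤ 2 (*-monoʳ-≤ 2 (handshake f inj G)) ⟩
    2 * (2 * (2 * length G))                ≡⟨ eight (length G) ⟩
    8 * length G                            ∎
    where
    open ≤-Reasoning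
    eight : ∀ m → 2 * (2 * (2 * m)) ≡ 8 * m
    eight m = solve (m ∷ [])
    deg : Fin (suc k) → ℕ
    deg = degree G ∘ f
    consecutive : ∀ (i : Fin k) → Graph._~_ (path k) (inject₁ i) (fsuc i)
    consecutive i = inj₁ (cong suc (sym (Fin.toℕ-inject₁ i)))
    colour : Fin k → ℕ
    colour i = proj₁ (copy _ _ (consecutive i))
    edge : ∀ i → HasEdge G (f (inject₁ i)) (f (fsuc i)) (colour i)
    edge i = proj₂ (copy _ _ (consecutive i))
    positive : ∀ i → 1 ≤ colour i
    positive i = positive-colour play (edge i)
    colour-injective : Injective _≡_ _≡_ colour
    colour-injective {i} {j} eq
      with rainbow _ _ _ _ _ (consecutive i) (consecutive j) (edge i)
        (subst (HasEdge G _ _) (sym eq) (edge j))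
    ... | inj₁ (p , _) = Fin.inject₁-injective p
    -- A reversed match would need `i = j + 1` and `j = i + 1` at once.
    ... | inj₂ (p , q) = ⊥-elim (<-asym
      (≤-reflexive (trans (cong toℕ q) (Fin.toℕ-inject₁ j)))
      (≤-reflexive (sym (trans (sym (Fin.toℕ-inject₁ i)) (cong toℕ p)))))

  -- Upper bound

  open Target

  infixl 6 _⊕_
  _⊕_ : ∀ {a b c d} → a ≤ b → c ≤ d → a + c ≤ b + d
  _⊕_ = +-mono-≤

  -- Linear arithmetic by certificates: hypotheses are added up with ⊕, and the ring solver compares sides.
  absurd-≤ : ∀ r {a b} → a ≤ b → a ≡ suc b + r → ⊥
  absurd-≤ r {b = b} h refl = 1+n≰n (≤-trans (m≤m+n (suc b) r) h)

  -- The equation exhibits `y − x` as `r` plus the slack `b − a` of the combined hypotheses.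
  by-≤ : ∀ r {a b x y} → a ≤ b → a + y ≡ r + b + x → x ≤ y
  by-≤ r {a} {b} {x} {y} h eq = +-cancelˡ-≤ a x y
    (≤-trans (+-monoˡ-≤ x h) (≤-trans (≤-trans (m≤n+m _ r) (≤-reflexive (sym (+-assoc r b x))))
      (≤-reflexive (sym eq))))

  by-≡ : ∀ {a b x y} → a ≡ b → a + y ≡ b + x → x ≡ y
  by-≡ {a} {x = x} {y} refl eq = sym (+-cancelˡ-≡ a y x eq)

  ≡⇒≤ : ∀ {a b : ℕ} → a ≡ b → a ≤ b
  ≡⇒≤ = ≤-reflexive

  ≡⇒≥ : ∀ {a b : ℕ} → a ≡ b → b ≤ a
  ≡⇒≥ = ≤-reflexive ∘ sym

  data Parity : ℕ → Set where
    even : ∀ j → Parity (2 * j)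
    odd  : ∀ j → Parity (1 + 2 * j)

  parity : ∀ m → Parity m
  parity zero = even 0
  parity (suc m) with parity m
  ... | even j = odd j
  ... | odd j  = subst Parity (*-suc 2 j) (even (suc j))

  half-≤ : ∀ {i j} → 2 * i ≤ 1 + 2 * j → i ≤ j
  half-≤ {i} {j} h = ≮⇒≥ λ (j<i : j < i) → absurd-≤ 0 (h ⊕ j<i ⊕ j<i) (solve (i ∷ j ∷ []))

  -- The target colouring and its properness

  module Construction (B k : ℕ) (k+2≤4B : k + 2 ≤ 4 * B) where

    -- A filling edge of colour c joins vertices with sum 4B + 4 + c; the helping
    -- edges give the centre the six colours that this rule would assign to
    -- vertices too close to it.
    data Fan (b v c : ℕ) : Set where
      fill : v + 2 * b ≡ 2 * B + 2 + c → v + 3 ≤ 2 * (1 + B + b) → Fan b v c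
      help : ∀ d → d ≤ 5 → c + 2 ≡ 4 * b + d → v ≡ 4 * B + 3 + d → Fan b v c

    -- The centres are the even numbers from `2B + 2` to `4B + 2`, all below the helpers.
    data Edgeℕ : ℕ → ℕ → ℕ → Set where
      fan  : ∀ {b v c} → b ≤ B → Fan b v c → Edgeℕ (2 * (1 + B + b)) v c
      link : ∀ {c} → c ≤ k → Edgeℕ c (suc c) c

    centre-injective : ∀ {b b′} → 2 * (1 + B + b) ≡ 2 * (1 + B + b′) → b ≡ b′
    centre-injective {b} {b′} eq = +-cancelˡ-≡ (1 + B) b b′ (*-cancelˡ-≡ (1 + B + b) (1 + B + b′) 2 eq)

    centre≢helper : ∀ {b d} → b ≤ B → 2 * (1 + B + b) ≢ 4 * B + 3 + d
    centre≢helper {b} {d} b≤B eq = absurd-≤ d (≡⇒≥ eq ⊕ b≤B ⊕ b≤B) (solve (b ∷ B ∷ d ∷ []))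

    fill≢helper : ∀ {b v d} → b ≤ B → v + 3 ≤ 2 * (1 + B + b) → v ≢ 4 * B + 3 + d
    fill≢helper {b} {v} {d} b≤B h eq =
      absurd-≤ (3 + d) (h ⊕ ≡⇒≥ eq ⊕ b≤B ⊕ b≤B) (solve (b ∷ v ∷ B ∷ d ∷ []))

    -- Equal colours mean equal sums, so the remaining end and centre would coincide too; but each
    -- centre exceeds its end by at least three.
    fills-apart : ∀ {b b′ v v′ c} → v + 2 * b ≡ 2 * B + 2 + c → v + 3 ≤ 2 * (1 + B + b) →
                  v′ + 2 * b′ ≡ 2 * B + 2 + c → v′ + 3 ≤ 2 * (1 + B + b′) → 2 * (1 + B + b) ≢ v′
    fills-apart {b} {b′} {v} {v′} {c} e h e′ h′ eq =
      absurd-≤ 5 (h ⊕ h′ ⊕ ≡⇒≤ e′ ⊕ ≡⇒≥ e ⊕ ≡⇒≤ eq ⊕ ≡⇒≤ eq) (solve (b ∷ b′ ∷ v ∷ v′ ∷ c ∷ B ∷ []))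

    -- The fill centre would be at least three above the other centre by its gap, and at most three
    -- above it because `d ≤ 5`. Both are even, so three is impossible; hence the split at `1 + b`.
    help-fill-apart : ∀ {b b′ v′ c d} → d ≤ 5 → c + 2 ≡ 4 * b + d →
                      v′ + 2 * b′ ≡ 2 * B + 2 + c → v′ + 3 ≤ 2 * (1 + B + b′) → 2 * (1 + B + b) ≢ v′
    help-fill-apart {b} {b′} {v′} {c} {d} d≤5 e e′ h′ eq =
      [ (λ (b′≤1+b : b′ ≤ 1 + b) →
          absurd-≤ 0 (h′ ⊕ ≡⇒≤ eq ⊕ b′≤1+b ⊕ b′≤1+b) (solve (b ∷ b′ ∷ v′ ∷ B ∷ [])))
      , (λ (1+b<b′ : 1 + b < b′) →
          absurd-≤ 0 (≡⇒≤ e′ ⊕ ≡⇒≤ eq ⊕ ≡⇒≤ e ⊕ d≤5 ⊕ 1+b<b′ ⊕ 1+b<b′)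
            (solve (b ∷ b′ ∷ v′ ∷ B ∷ c ∷ d ∷ [])))
      ]′ (≤-<-connex b′ (1 + b))

    fans-apart : ∀ {b b′ v v′ c} → Fan b v c → Fan b′ v′ c → b ≤ B → 2 * (1 + B + b) ≢ v′
    fans-apart {b} (fill e h) (fill e′ h′) _ = fills-apart {b} e h e′ h′
    fans-apart {b} (help _ d≤5 e _) (fill e′ h′) _ = help-fill-apart {b} d≤5 e e′ h′
    fans-apart {b} _ (help d _ _ refl) b≤B = centre≢helper {b} b≤B

    -- The gap of three keeps fill colours at `4b − 3` or less, while helping colours start at
    -- `4b − 2`.
    fill-help : ∀ {b v c d} → v + 2 * b ≡ 2 * B + 2 + c → v + 3 ≤ 2 * (1 + B + b) → c + 2 ≢ 4 * b + d
    fill-help {b} {v} {c} {d} e h e′ =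
      absurd-≤ d (h ⊕ ≡⇒≥ e ⊕ ≡⇒≥ e′) (solve (b ∷ v ∷ c ∷ d ∷ B ∷ []))

    same-centre : ∀ {b v v′ c} → Fan b v c → Fan b v′ c → v ≡ v′
    same-centre {b} {v} {v′} (fill e _) (fill e′ _) = +-cancelʳ-≡ (2 * b) v v′ (trans e (sym e′))
    same-centre (fill e h) (help _ _ e′ _) = ⊥-elim (fill-help e h e′)
    same-centre (help _ _ e _) (fill e′ h′) = ⊥-elim (fill-help e′ h′ e)
    same-centre {b} (help d _ e refl) (help d′ _ e′ refl) =
      cong (4 * B + 3 +_) (+-cancelˡ-≡ (4 * b) d d′ (trans (sym e) e′))

    -- A fill's sum fixes its centre. A helper's colour rises by four from one centre to the next,
    -- which lets all centres share the six helpers.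
    same-end : ∀ {b b′ v c} → Fan b v c → Fan b′ v c → b ≤ B → b′ ≤ B → b ≡ b′
    same-end {b} {b′} {v} (fill e _) (fill e′ _) _ _ =
      *-cancelˡ-≡ b b′ 2 (+-cancelˡ-≡ v _ _ (trans e (sym e′)))
    same-end (fill _ h) (help _ _ _ eq) b≤B _ = ⊥-elim (fill≢helper b≤B h eq)
    same-end (help _ _ _ eq) (fill _ h) _ b′≤B = ⊥-elim (fill≢helper b′≤B h eq)
    same-end {b} {b′} (help d _ e refl) (help d′ _ e′ eq) _ _
      with refl ← +-cancelˡ-≡ (4 * B + 3) d d′ eq =
      *-cancelˡ-≡ b b′ 4 (+-cancelʳ-≡ d _ _ (trans (sym e) e′))

    fan-proper : ∀ {b b′ v v′ c} → Fan b v c → Fan b′ v′ c → b ≤ B → b′ ≤ B →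
                 Meet (2 * (1 + B + b)) v (2 * (1 + B + b′)) v′ →
                   2 * (1 + B + b) ≡ 2 * (1 + B + b′) × v ≡ v′
    fan-proper f f′ _ _ (inj₁ (inj₁ eq)) with refl ← centre-injective eq = refl , same-centre f f′
    fan-proper f f′ p _ (inj₁ (inj₂ eq)) = ⊥-elim (fans-apart f f′ p eq)
    fan-proper f f′ _ p (inj₂ (inj₁ eq)) = ⊥-elim (fans-apart f′ f p (sym eq))
    fan-proper f f′ p p′ (inj₂ (inj₂ refl)) with refl ← same-end f f′ p p′ = refl , refl

    -- A link of colour c uses only vertices up to c + 1, too small to carry a fan edge of colour c.
    fill-bound : ∀ {b v c} → b ≤ B → v + 2 * b ≡ 2 * B + 2 + c → c + 2 ≤ v
    fill-bound {b} {v} {c} b≤B e =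
      by-≤ 0 (≡⇒≥ e ⊕ b≤B ⊕ b≤B) (solve (b ∷ v ∷ c ∷ B ∷ []))

    -- For the centre `x`, `2x = 4B + 6 + c − d ≥ 4B + 1 + c ≥ 2c + 3`, and integrality gives `x ≥ c
    -- + 2`.
    help-bound : ∀ {b c d} → b ≤ B → d ≤ 5 → c + 2 ≡ 4 * b + d → c ≤ k → c + 2 ≤ 2 * (1 + B + b)
    help-bound {b} {c} {d} b≤B d≤5 e c≤k = ≮⇒≥ λ (small : 2 * (1 + B + b) < c + 2) → absurd-≤ 0
      (small ⊕ small ⊕ ≡⇒≤ e ⊕ c≤k ⊕ k+2≤4B ⊕ d≤5)
      (solve (b ∷ c ∷ d ∷ B ∷ k ∷ []))

    fan-beyond-links : ∀ {b v c} → Fan b v c → b ≤ B → c ≤ k → c + 2 ≤ 2 * (1 + B + b) × c + 2 ≤ v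
    fan-beyond-links {b} {v} (fill e h) b≤B _ =
      ≤-trans (fill-bound b≤B e) (≤-trans (m≤m+n v 3) h) , fill-bound b≤B e
    fan-beyond-links {c = c} (help d d≤5 e refl) b≤B c≤k =
      help-bound b≤B d≤5 e c≤k ,
      ≤-trans (≤-trans (+-monoˡ-≤ 2 c≤k) k+2≤4B) (≤-trans (m≤m+n (4 * B) 3) (m≤m+n (4 * B + 3) d))

    fan-link-apart : ∀ {b v c} → Fan b v c → b ≤ B → c ≤ k → ¬ Meet (2 * (1 + B + b)) v c (suc c)
    fan-link-apart {b} {v} {c} f b≤B c≤k with fan-beyond-links f b≤B c≤k
    ... | x≥ , v≥ = [ [ far x≥ , far′ x≥ ]′ , [ far v≥ , far′ v≥ ]′ ]′
      where
      far : ∀ {w} → c + 2 ≤ w → w ≢ c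
      far h refl = absurd-≤ 1 h (solve (c ∷ []))
      far′ : ∀ {w} → c + 2 ≤ w → w ≢ suc c
      far′ h refl = absurd-≤ 0 h (solve (c ∷ []))

    apart-not-link : ∀ {x v c} → v + 3 ≤ x → ¬ SamePair x v c (suc c)
    apart-not-link {c = c} h (inj₁ (refl , refl)) = absurd-≤ 3 h (solve (c ∷ []))
    apart-not-link {c = c} h (inj₂ (refl , refl)) = absurd-≤ 1 h (solve (c ∷ []))

    helper-not-link : ∀ {x d c} → c ≤ k → ¬ SamePair x (4 * B + 3 + d) c (suc c)
    helper-not-link {x} {d} {c} c≤k = [ (λ (_ , eq) → far eq) , (λ (_ , eq) → far′ eq) ]′
      where
      far : 4 * B + 3 + d ≢ suc c
      far eq = absurd-≤ (3 + d) (c≤k ⊕ k+2≤4B ⊕ ≡⇒≤ eq) (solve (c ∷ d ∷ B ∷ k ∷ []))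
      far′ : 4 * B + 3 + d ≢ c
      far′ eq = absurd-≤ (4 + d) (c≤k ⊕ k+2≤4B ⊕ ≡⇒≤ eq) (solve (c ∷ d ∷ B ∷ k ∷ []))

    fan-not-link : ∀ {b v c c′} → Fan b v c → c′ ≤ k → ¬ SamePair (2 * (1 + B + b)) v c′ (suc c′)
    fan-not-link (fill _ h) _ = apart-not-link h
    fan-not-link (help d _ _ refl) c′≤k = helper-not-link c′≤k

    apart-not-swapped : ∀ {x v x′ v′} → v + 3 ≤ x → v′ + 3 ≤ x′ → x ≡ v′ → v ≢ x′
    apart-not-swapped {x} {v} h h′ refl refl = absurd-≤ 5 (h ⊕ h′) (solve (x ∷ v ∷ []))

    -- Fills run from the larger vertex to the smaller and helpers are never centres, so no pair
    -- occurs in both orientations.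
    fan-simple : ∀ {b b′ v v′ c c′} → Fan b v c → Fan b′ v′ c′ → b ≤ B → b′ ≤ B →
                 SamePair (2 * (1 + B + b)) v (2 * (1 + B + b′)) v′ → c ≡ c′
    fan-simple {b} f f′ b≤B _ (inj₁ (eq , refl)) with refl ← centre-injective eq = same f f′
      where
      same : ∀ {v c c′} → Fan b v c → Fan b v c′ → c ≡ c′
      same (fill e _) (fill e′ _) = +-cancelˡ-≡ (2 * B + 2) _ _ (trans (sym e) e′)
      same (fill _ h) (help _ _ _ eq) = ⊥-elim (fill≢helper b≤B h eq)
      same (help _ _ _ eq) (fill _ h) = ⊥-elim (fill≢helper b≤B h eq)
      same {c = c} {c′} (help d _ e refl) (help d′ _ e′ eq)
        with refl ← +-cancelˡ-≡ (4 * B + 3) d d′ eq = +-cancelʳ-≡ 2 c c′ (trans e (sym e′))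
    fan-simple (help d _ _ refl) f′ _ b′≤B (inj₂ (_ , eq)) = ⊥-elim (centre≢helper b′≤B (sym eq))
    fan-simple (fill _ _) (help _ _ _ refl) b≤B _ (inj₂ (eq , _)) = ⊥-elim (centre≢helper b≤B eq)
    fan-simple (fill _ h) (fill _ h′) _ _ (inj₂ (eq , eq′)) = ⊥-elim (apart-not-swapped h h′ eq eq′)

    targetℕ : Target ℕ
    targetℕ = record { Edge = Edgeℕ ; irrefl = irreflexive ; proper = proper′ ; simple = simple′ }
      where
      irreflexive : ∀ {u v c} → Edgeℕ u v c → u ≢ v
      irreflexive (fan _ (fill _ h)) eq =
        <⇒≢ (≤-trans (≤-trans (≤-reflexive (+-comm 1 _)) (+-monoʳ-≤ _ (s≤s z≤n))) h) (sym eq)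
      irreflexive (fan b≤B (help _ _ _ refl)) eq = centre≢helper b≤B eq
      irreflexive (link _) eq = 1+n≢n (sym eq)

      meet-sym : ∀ {u v u′ v′ : ℕ} → Meet u v u′ v′ → Meet u′ v′ u v
      meet-sym (inj₁ (inj₁ p)) = inj₁ (inj₁ (sym p))
      meet-sym (inj₁ (inj₂ p)) = inj₂ (inj₁ (sym p))
      meet-sym (inj₂ (inj₁ p)) = inj₁ (inj₂ (sym p))
      meet-sym (inj₂ (inj₂ p)) = inj₂ (inj₂ (sym p))

      proper′ : ∀ {u v u′ v′ c} → Edgeℕ u v c → Edgeℕ u′ v′ c → Meet u v u′ v′ → u ≡ u′ × v ≡ v′
      proper′ (fan p f) (fan p′ f′) m = fan-proper f f′ p p′ m
      proper′ (fan p f) (link c≤k)  m = ⊥-elim (fan-link-apart f p c≤k m)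
      proper′ (link c≤k) (fan p f)  m = ⊥-elim (fan-link-apart f p c≤k (meet-sym m))
      proper′ (link _) (link _)     m = refl , refl

      pair-sym : ∀ {u v u′ v′ : ℕ} → SamePair u v u′ v′ → SamePair u′ v′ u v
      pair-sym (inj₁ (p , q)) = inj₁ (sym p , sym q)
      pair-sym (inj₂ (p , q)) = inj₂ (sym q , sym p)

      simple′ : ∀ {u v u′ v′ c c′} → Edgeℕ u v c → Edgeℕ u′ v′ c′ → SamePair u v u′ v′ → c ≡ c′
      simple′ (fan p f) (fan p′ f′) m = fan-simple f f′ p p′ m
      simple′ (fan _ f) (link c≤k)  m = ⊥-elim (fan-not-link f c≤k m)
      simple′ (link c≤k) (fan _ f)  m = ⊥-elim (fan-not-link f c≤k (pair-sym m))
      simple′ (link _) (link _) (inj₁ (p , _)) = p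
      simple′ (link {c} _) (link _) (inj₂ (refl , q)) = ⊥-elim (<⇒≢ (s≤s (n≤1+n _)) (sym q))

  pullback : ∀ {A C : Set} (f : A → C) → (∀ {x y} → f x ≡ f y → x ≡ y) → Target C → Target A
  pullback f inj T = record
    { Edge   = λ u v → Edge T (f u) (f v)
    ; irrefl = λ e eq → irrefl T e (cong f eq)
    ; proper = λ e e′ m → let p , q = proper T e e′ (meet m) in inj p , inj q
    ; simple = λ e e′ → simple T e e′ ∘ pair
    }
    where
    meet : ∀ {u v u′ v′} → Meet u v u′ v′ → Meet (f u) (f v) (f u′) (f v′)
    meet = Sum.map (Sum.map (cong f) (cong f)) (Sum.map (cong f) (cong f))
    pair : ∀ {u v u′ v′} → SamePair u v u′ v′ → SamePair (f u) (f v) (f u′) (f v′)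
    pair = Sum.map (λ (p , q) → cong f p , cong f q) (λ (p , q) → cong f p , cong f q)

  -- Presenting the target edge by edge

  module Build (B k : ℕ) (k+2≤4B : k + 2 ≤ 4 * B) where
    open Construction B k k+2≤4B

    -- The largest vertex is the last helper, `4B + 8`.
    n : ℕ
    n = suc (4 * B + 8)

    -- Reduction modulo `n` only makes the map total; the indices in use lie below `n`.
    vertex : ℕ → Fin n
    vertex i = fromℕ< (m%n<n i n)

    toℕ-vertex : ∀ {i} → i < n → toℕ (vertex i) ≡ i
    toℕ-vertex {i} i<n = trans (Fin.toℕ-fromℕ< (m%n<n i n)) (m<n⇒m%n≡m i<n)

    vertex-injective : ∀ {i j} → i < n → j < n → vertex i ≡ vertex j → i ≡ j
    vertex-injective i<n j<n eq = trans (sym (toℕ-vertex i<n)) (trans (cong toℕ eq) (toℕ-vertex j<n))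

    target : Target (Fin n)
    target = pullback toℕ Fin.toℕ-injective targetℕ

    open Playing target

    edge : ∀ {x v c} → x < n → v < n → Edgeℕ x v c → Edge target (vertex x) (vertex v) c
    edge x<n v<n e = subst₂ (λ x v → Edgeℕ x v _) (sym (toℕ-vertex x<n)) (sym (toℕ-vertex v<n)) e

    centre<n : ∀ {b} → b ≤ B → 2 * (1 + B + b) < suc (4 * B + 8)
    centre<n {b} b≤B = by-≤ 6 (b≤B ⊕ b≤B) (solve (b ∷ B ∷ []))

    fill-close : ∀ {b v c} → v + 2 * b ≡ 2 * B + 2 + c → c + 3 ≤ 4 * b → v + 3 ≤ 2 * (1 + B + b)
    fill-close {b} {v} {c} e h = by-≤ 0 (≡⇒≤ e ⊕ h) (solve (b ∷ v ∷ c ∷ B ∷ []))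

    helper-index : ∀ {b c d} → d + 4 * b ≡ c + 2 → c ≤ 4 * b + 3 → d ≤ 5
    helper-index {b} {c} {d} e h = by-≤ 0 (≡⇒≤ e ⊕ h) (solve (b ∷ c ∷ d ∷ []))

    helper<n : ∀ {d} → d ≤ 5 → 4 * B + 3 + d < suc (4 * B + 8)
    helper<n {d} h = by-≤ 0 h (solve (d ∷ B ∷ []))

    -- A colour that leaves the gap of three at this centre uses a fill edge; the others, up to
    -- `4b + 3`, use the helpers.
    neighbour : ∀ {b c} → b ≤ B → c ≤ 4 * b + 3 → ∃[ v ] Fan b v c × v < n
    neighbour {b} {c} b≤B c≤ with c + 3 ≤? 4 * b
    ... | yes near = v , fill v+2b close , ≤-trans (s≤s (≤-trans (m≤m+n v 3) close)) (centre<n b≤B)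
      where
      v = 2 * B + 2 + c ∸ 2 * b
      v+2b : v + 2 * b ≡ 2 * B + 2 + c
      v+2b = m∸n+n≡m (≤-trans (*-monoʳ-≤ 2 b≤B) (≤-trans (m≤m+n (2 * B) 2) (m≤m+n (2 * B + 2) c)))
      close : v + 3 ≤ 2 * (1 + B + b)
      close = fill-close {b} v+2b near
    ... | no ¬near = 4 * B + 3 + d , help d d≤5 (trans (sym d+4b) (+-comm d (4 * b))) refl , helper<n d≤5
      where
      d = c + 2 ∸ 4 * b
      d+4b : d + 4 * b ≡ c + 2
      d+4b = m∸n+n≡m (s≤s⁻¹ (≤-trans (≰⇒> ¬near) (≤-reflexive (+-suc c 2))))
      d≤5 : d ≤ 5
      d≤5 = helper-index {b} {c} {d} d+4b c≤

    HasFan : ℕ → ℕ → Stage → Set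
    HasFan b m S = ∀ {v c} → 1 ≤ c → c ≤ m → Fan b v c → (vertex (2 * (1 + B + b)) , vertex v , c) ∈ graph S

    -- Colours are added in increasing order, so the centre alone sees all smaller ones, whatever
    -- the other end carries.
    present-fan : ∀ S {b} → b ≤ B → ∀ m → m ≤ 4 * b + 3 → ∃[ S′ ] S ⊑[ m ] S′ × HasFan b m S′
    present-fan S b≤B zero _ = S , (id , ≤-refl) , λ { {c = suc _} _ () }
    present-fan S {b} b≤B (suc m) m<
      with S′ , S⊑S′ , has ← present-fan S b≤B m (<⇒≤ m<)
      with v , f , v<n ← neighbour b≤B m<
      with S″ , S′⊑S″ , new ← extend S′ (edge (centre<n b≤B) v<n (fan b≤B f)) (s≤s z≤n)
             (λ 1≤c′ c′<c → let v′ , f′ , _ = neighbour b≤B (<⇒≤ (≤-trans c′<c m<))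
                            in inj₁ (vertex v′ , inj₁ (has 1≤c′ (s≤s⁻¹ c′<c) f′)))
      = S″ , ⊑-trans {S} {S′} {S″} S⊑S′ S′⊑S″ , has′
      where
      has′ : HasFan b (suc m) S″
      has′ {v′} 1≤c c≤ f′ with m≤n⇒m<n∨m≡n c≤
      ... | inj₁ c<   = proj₁ S′⊑S″ (has 1≤c (s≤s⁻¹ c<) f′)
      ... | inj₂ refl = subst (λ v → (_ , vertex v , _) ∈ graph S″) (same-centre f f′) new

    HasFans : ℕ → Stage → Set
    HasFans m S = ∀ {b} → b < m → HasFan b (4 * b + 3) S

    -- No fan relies on another. The centre of index `b` costs `4b + 3` edges, and these costs add
    -- up to `m(2m + 1)`.
    present-fans : ∀ m → m ≤ suc B → ∃[ S ] length (graph S) ≤ m * (2 * m + 1) × HasFans m S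
    present-fans zero _ = record { graph = [] ; play = start ; sound = λ () } , z≤n , λ ()
    present-fans (suc m) m≤B
      with S , size , has ← present-fans m (<⇒≤ m≤B)
      with S′ , (S⊆S′ , size′) , new ← present-fan S (s≤s⁻¹ m≤B) (4 * m + 3) ≤-refl
      = S′ , ≤-trans size′ (≤-trans (+-monoʳ-≤ (4 * m + 3) size) (≤-reflexive (count m))) , has′
      where
      count : ∀ m → 4 * m + 3 + m * (2 * m + 1) ≡ suc m * (2 * suc m + 1)
      count m = solve (m ∷ [])
      has′ : HasFans (suc m) S′
      has′ b<1+m 1≤c c≤ f with m≤n⇒m<n∨m≡n (s≤s⁻¹ b<1+m)
      ... | inj₁ b<m  = S⊆S′ (has b<m 1≤c c≤ f)
      ... | inj₂ refl = new 1≤c c≤ f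

    module _ {S : Stage} (has : HasFans (suc B) S) where

      centre-sees : ∀ {b c} → b ≤ B → 1 ≤ c → c ≤ 4 * b + 3 →
        ColourAt (graph S) (vertex (2 * (1 + B + b))) c
      centre-sees b≤B 1≤c c≤ with v , f , _ ← neighbour b≤B c≤ = vertex v , inj₁ (has (s≤s b≤B) 1≤c c≤ f)

      fill-eq : ∀ {w b r c} → b + r ≡ B → w ≡ c + 2 + 2 * r → w + 2 * b ≡ 2 * B + 2 + c
      fill-eq {w} {b} {r} {c} b+r w≡ =
        by-≡ (cong₂ _+_ w≡ (cong₂ _+_ b+r b+r)) (solve (w ∷ b ∷ r ∷ c ∷ B ∷ []))

      fill-colour : ∀ {b r c} → b + r ≡ B → c + 3 + 4 * r ≤ 4 * B → c + 3 ≤ 4 * b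
      fill-colour {b} {r} {c} e h = by-≤ 0 (h ⊕ ≡⇒≥ e ⊕ ≡⇒≥ e ⊕ ≡⇒≥ e ⊕ ≡⇒≥ e) (solve (b ∷ r ∷ c ∷ B ∷ []))

      -- Here `r` counts centres down from the top one, so the fill edge comes from the centre
      -- `4B + 2 − 2r`; the last hypothesis is its gap of three from `w`.
      end-sees : ∀ {w c} r → 1 ≤ c → w ≡ c + 2 + 2 * r → c + 3 + 4 * r ≤ 4 * B →
        ColourAt (graph S) (vertex w) c
      end-sees {w} {c} r 1≤c w≡ h = vertex (2 * (1 + B + b)) ,
        inj₂ (has {b} (s≤s (m∸n≤m B r)) {w} 1≤c (≤-trans (m≤m+n c 3) (≤-trans c+3≤4b (m≤m+n (4 * b) 3)))
          (fill w+2b (fill-close {b} {w} w+2b c+3≤4b)))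
        where
        b = B ∸ r
        b+r : b + r ≡ B
        b+r = m∸n+n≡m {B} {r} (*-cancelˡ-≤ {r} {B} 4 (≤-trans (m≤n+m (4 * r) (c + 3)) h))
        w+2b : w + 2 * b ≡ 2 * B + 2 + c
        w+2b = fill-eq {w} {b} {r} b+r w≡
        c+3≤4b : c + 3 ≤ 4 * b
        c+3≤4b = fill-colour {b} {r} b+r h

      -- A colour c below y is seen from the even endpoint e if c ≤ 2e − 4B − 1; larger colours
      -- come from fans of larger centres, at the endpoint that has the parity of c.
      sees-below : ∀ {j c} e → 1 ≤ c → e ≤ k + 1 → e ≡ 2 * j → c + 4 * B + 4 ≤ 2 * e + 3 →
                   ColourAt (graph S) (vertex e) c
      sees-below {j} {c} e 1≤c e≤ e≡ h = subst (λ e → ColourAt (graph S) (vertex e) c) (sym e≡′)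
          (centre-sees {b} (small-centre e≤ e≡′) 1≤c (low-colour {e} {b} e≡′ h))
        where
        -- `c ≥ 1` gives `e ≥ 2B + 1`, and evenness raises this to `2B + 2`, the smallest centre.
        large : ∀ {e j} → 1 ≤ c → e ≡ 2 * j → c + 4 * B + 4 ≤ 2 * e + 3 → 1 + B ≤ j
        large {e} {j} 1≤c e≡ h = ≮⇒≥ λ (small : j < 1 + B) →
          absurd-≤ 1 (h ⊕ ≡⇒≤ e≡ ⊕ ≡⇒≤ e≡ ⊕ small ⊕ small ⊕ small ⊕ small ⊕ 1≤c)
            (solve (e ∷ j ∷ c ∷ B ∷ []))
        b = j ∸ (1 + B)
        e≡′ : e ≡ 2 * (1 + B + b)
        e≡′ = trans e≡ (cong (2 *_) (sym (m+[n∸m]≡n (large {e} {j} 1≤c e≡ h))))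
        small-centre : ∀ {e b} → e ≤ k + 1 → e ≡ 2 * (1 + B + b) → b ≤ B
        small-centre {e} {b} e≤ e≡ = ≮⇒≥ λ (big : B < b) →
          absurd-≤ 4 (e≤ ⊕ ≡⇒≥ e≡ ⊕ k+2≤4B ⊕ big ⊕ big) (solve (e ∷ b ∷ k ∷ B ∷ []))
        low-colour : ∀ {e b} → e ≡ 2 * (1 + B + b) → c + 4 * B + 4 ≤ 2 * e + 3 → c ≤ 4 * b + 3
        low-colour {e} {b} e≡ h = by-≤ 0 (h ⊕ ≡⇒≤ e≡ ⊕ ≡⇒≤ e≡) (solve (e ∷ b ∷ c ∷ B ∷ []))

      gap : ∀ {m i} → 1 + i ≤ m → ∃[ r ] m ≡ i + 1 + r
      gap {m} {i} h = m ∸ (1 + i) , trans (sym (m+[n∸m]≡n h)) (cong (_+ (m ∸ (1 + i))) (+-comm 1 i))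

      -- Failing the test of `sees-below` gives the gap condition of `end-sees` with one to spare.
      sees-above : ∀ {e c} → (∃[ r ] e ≡ c + 2 + 2 * r) → 1 ≤ c → 2 * e + 3 < c + 4 * B + 4 →
                   ColourAt (graph S) (vertex e) c
      sees-above {e} {c} (r , e≡) 1≤c h = end-sees r 1≤c e≡ (bound {r} e≡ h)
        where
        bound : ∀ {r} → e ≡ c + 2 + 2 * r → 2 * e + 3 < c + 4 * B + 4 → c + 3 + 4 * r ≤ 4 * B
        bound {r} e≡ h = by-≤ 1 (h ⊕ ≡⇒≥ e≡ ⊕ ≡⇒≥ e≡) (solve (e ∷ r ∷ c ∷ B ∷ []))

      even-gap : ∀ {e j i} → e ≡ 2 * j → 1 + i ≤ j → ∃[ r ] e ≡ 2 * i + 2 + 2 * r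
      even-gap {e} {j} {i} e≡ h with r , j≡ ← gap h = r , by-≡ (cong₂ _+_ e≡ (cong₂ _+_ j≡ j≡)) (double r)
        where
        double : ∀ r → e + (j + j) + (2 * i + 2 + 2 * r) ≡ 2 * j + (i + 1 + r + (i + 1 + r)) + e
        double r = solve (e ∷ j ∷ i ∷ r ∷ [])

      -- The test was made at the even endpoint, and its failure yields only `2i + 4r + 3 ≤ 4B`, one
      -- short of the gap condition; parity recovers the one.
      odd-sees : ∀ {i j} → 1 + i ≤ j → 4 * j + 4 ≤ 1 + 2 * i + 4 * B + 4 →
        ColourAt (graph S) (vertex (1 + 2 * j)) (1 + 2 * i)
      odd-sees {i} {j} h h′ with r , j≡ ← gap h =
        end-sees r (s≤s z≤n) (shift {r} j≡) (bound {r} (half-≤ (parity-bound {r} j≡)))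
        where
        shift : ∀ {r} → j ≡ i + 1 + r → 1 + 2 * j ≡ 1 + 2 * i + 2 + 2 * r
        shift {r} eq = by-≡ (cong₂ _+_ eq eq) (solve (i ∷ j ∷ r ∷ []))
        parity-bound : ∀ {r} → j ≡ i + 1 + r → 2 * (i + 2 + 2 * r) ≤ 1 + 2 * (2 * B)
        parity-bound {r} eq = by-≤ 0 (h′ ⊕ ≡⇒≥ eq ⊕ ≡⇒≥ eq ⊕ ≡⇒≥ eq ⊕ ≡⇒≥ eq) (solve (i ∷ j ∷ r ∷ B ∷ []))
        bound : ∀ {r} → i + 2 + 2 * r ≤ 2 * B → 1 + 2 * i + 3 + 4 * r ≤ 4 * B
        bound {r} x = by-≤ 0 (x ⊕ x) (solve (i ∷ r ∷ B ∷ []))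

      evens-see : ∀ {e j c} → e ≡ 2 * j → 1 ≤ c → e ≤ k + 1 → (∃[ i ] c ≡ 2 * i × 1 + i ≤ j) →
        ColourAt (graph S) (vertex e) c
      evens-see {e} {j} {c} e≡ 1≤c e≤ (i , refl , h) with ≤-<-connex (c + 4 * B + 4) (2 * e + 3)
      ... | inj₁ low  = sees-below {j} e 1≤c e≤ e≡ low
      ... | inj₂ high = sees-above (even-gap {e} {j} e≡ h) 1≤c high

      -- The even endpoint sees all smaller even colours and the low odd ones; the odd endpoint
      -- takes over for the high odd ones.
      endpoints-see : ∀ {y c} → 1 ≤ c → c < y → y ≤ k → Sees (graph S) (vertex y) (vertex (suc y)) c
      endpoints-see {y} {c} 1≤c c<y y≤k with parity y | parity c
      ... | even j | even i = inj₁ (evens-see {j = j} refl 1≤c (≤-trans y≤k (m≤m+n k 1)) (i , refl , i<j))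
        where
        i<j : i < j
        i<j = *-cancelˡ-< 2 i j c<y
      ... | odd j  | even i = inj₂ (evens-see {j = 1 + j} (sym (*-suc 2 j)) 1≤c
          (≤-trans (s≤s y≤k) (≤-reflexive (+-comm 1 k))) (i , refl , s≤s i≤j))
        where
        i≤j : i ≤ j
        i≤j = *-cancelˡ-≤ 2 (s≤s⁻¹ c<y)
      ... | even j | odd i with ≤-<-connex (1 + 2 * i + 4 * B + 4) (2 * (2 * j) + 3)
      ...   | inj₁ low  = inj₁ (sees-below {j} (2 * j) 1≤c (≤-trans y≤k (m≤m+n k 1)) refl low)
      ...   | inj₂ high = inj₂ (odd-sees i<j (above high))
        where
        i<j : i < j
        i<j = half-≤ (≤-trans (≤-reflexive (*-suc 2 i)) (m≤n⇒m≤1+n c<y))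
        above : 2 * (2 * j) + 3 < 1 + 2 * i + 4 * B + 4 → 4 * j + 4 ≤ 1 + 2 * i + 4 * B + 4
        above h = by-≤ 0 h (solve (i ∷ j ∷ B ∷ []))
      endpoints-see {y} {c} 1≤c c<y y≤k | odd j | odd i with ≤-<-connex (1 + 2 * i + 4 * B + 4)
        (2 * (2 + 2 * j) + 3)
      ...   | inj₁ low  = inj₂ (sees-below {1 + j} (2 + 2 * j) 1≤c
          (≤-trans (s≤s y≤k) (≤-reflexive (+-comm 1 k))) (sym (*-suc 2 j)) low)
      ...   | inj₂ high = inj₁ (odd-sees i<j (above high))
        where
        i<j : i < j
        i<j = half-≤ (≤-trans (≤-reflexive (*-suc 2 i)) c<y)
        above : 2 * (2 + 2 * j) + 3 < 1 + 2 * i + 4 * B + 4 → 4 * j + 4 ≤ 1 + 2 * i + 4 * B + 4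
        above h = by-≤ 4 h (solve (i ∷ j ∷ B ∷ []))

    HasLinks : ℕ → Stage → Set
    HasLinks m S = ∀ {c} → 1 ≤ c → c ≤ m → (vertex c , vertex (suc c) , c) ∈ graph S

    link<n : ∀ {c} → c ≤ k → suc c < n
    link<n {c} c≤k = s≤s (≤-trans (s≤s c≤k)
      (≤-trans (≤-trans (≤-reflexive (+-comm 1 k)) (+-monoʳ-≤ k (s≤s z≤n)))
      (≤-trans k+2≤4B (m≤m+n (4 * B) 8))))

    -- The fans in `S` already supply every smaller colour, and these stay visible in later stages;
    -- earlier links cannot occupy the new colour because the target is proper.
    present-links : ∀ {S} → HasFans (suc B) S → ∀ m → m ≤ k → ∃[ S′ ] S ⊑[ m ] S′ × HasLinks m S′
    present-links {S} has zero _ = S , (id , ≤-refl) , λ { {suc _} _ () }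
    present-links {S} has (suc m) m<k
      with S′ , S⊑S′ , has′ ← present-links {S} has m (<⇒≤ m<k)
      with S″ , S′⊑S″ , new ← extend S′ (edge (<⇒≤ (link<n m<k)) (link<n m<k) (link m<k)) (s≤s z≤n)
             (λ 1≤c c< → Sum.map (λ (x , e) → x , Sum.map (proj₁ S⊑S′) (proj₁ S⊑S′) e)
                                 (λ (x , e) → x , Sum.map (proj₁ S⊑S′) (proj₁ S⊑S′) e)
                                 (endpoints-see {S} has 1≤c c< m<k))
      = S″ , ⊑-trans {S} {S′} {S″} S⊑S′ S′⊑S″ , has″
      where
      has″ : HasLinks (suc m) S″
      has″ 1≤c c≤ with m≤n⇒m<n∨m≡n c≤
      ... | inj₁ c<   = proj₁ S′⊑S″ (has′ 1≤c (s≤s⁻¹ c<))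
      ... | inj₂ refl = new

    -- The rainbow path in the finished play

    module _ {S : Stage} (has : HasLinks k S) where
      open Graph (path k) using (_~_)

      -- Shifted by one, since the first link starts at vertex 1.
      place : Fin (suc k) → Fin n
      place i = vertex (suc (toℕ i))

      stepColour : ∀ {i j} → i ~ j → ℕ
      stepColour {i} {j} (inj₁ _) = suc (toℕ i)
      stepColour {i} {j} (inj₂ _) = suc (toℕ j)

      step-up : ∀ {i j : Fin (suc k)} → toℕ j ≡ suc (toℕ i) → (place i , place j , suc (toℕ i)) ∈ graph S
      step-up {i} {j} eq = subst (λ m → (place i , vertex (suc m) , suc (toℕ i)) ∈ graph S) (sym eq)
        (has (s≤s z≤n) (≤-trans (≤-reflexive (sym eq)) (Fin.toℕ≤pred[n] j)))

      step : ∀ {i j} (i~j : i ~ j) → HasEdge (graph S) (place i) (place j) (stepColour i~j)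
      step (inj₁ eq) = inj₁ (step-up eq)
      step (inj₂ eq) = inj₂ (step-up eq)

      unique-colour : ∀ {u v c c′} → HasEdge (graph S) u v c → HasEdge (graph S) u v c′ → c ≡ c′
      unique-colour (inj₁ e) (inj₁ e′) = simple target (sound S e) (sound S e′) (inj₁ (refl , refl))
      unique-colour (inj₁ e) (inj₂ e′) = simple target (sound S e) (sound S e′) (inj₂ (refl , refl))
      unique-colour (inj₂ e) (inj₁ e′) = simple target (sound S e) (sound S e′) (inj₂ (refl , refl))
      unique-colour (inj₂ e) (inj₂ e′) = simple target (sound S e) (sound S e′) (inj₁ (refl , refl))

      steps-apart : ∀ {i j i′ j′} (p : i ~ j) (q : i′ ~ j′) → stepColour p ≡ stepColour q →
        SamePair i j i′ j′
      steps-apart (inj₁ p) (inj₁ q) eq =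
        inj₁ (Fin.toℕ-injective (suc-injective eq) , Fin.toℕ-injective (trans p (trans eq (sym q))))
      steps-apart (inj₁ p) (inj₂ q) eq =
        inj₂ (Fin.toℕ-injective (suc-injective eq) , Fin.toℕ-injective (trans p (trans eq (sym q))))
      steps-apart (inj₂ p) (inj₁ q) eq =
        inj₂ (Fin.toℕ-injective (trans p (trans eq (sym q))) , Fin.toℕ-injective (suc-injective eq))
      steps-apart (inj₂ p) (inj₂ q) eq =
        inj₁ (Fin.toℕ-injective (trans p (trans eq (sym q))) , Fin.toℕ-injective (suc-injective eq))

      -- A pair carries one colour only, so any colour found on a step is its `stepColour`, which
      -- determines the step.
      rainbow-path : HasRainbowCopy (path k) (graph S)
      rainbow-path = place , (place-injective , λ i j i~j → stepColour i~j , step i~j) ,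
        λ i j i′ j′ c p q e e′ → steps-apart p q
          (trans (unique-colour (step p) e) (unique-colour e′ (step q)))
        where
        place<n : ∀ i → suc (toℕ i) < n
        place<n i = link<n (Fin.toℕ≤pred[n] i)
        place-injective : ∀ {i j} → place i ≡ place j → i ≡ j
        place-injective {i} {j} eq =
          Fin.toℕ-injective (suc-injective (vertex-injective (place<n i) (place<n j) eq))

    forced : ∃[ t ] Forces (path k) t × t ≤ k + suc B * (2 * suc B + 1)
    forced
      with S , size , fans ← present-fans (suc B) ≤-refl
      with S′ , (_ , size′) , links ← present-links {S} fans k ≤-refl
      = length (graph S′) , (n , graph S′ , play S′ , refl , rainbow-path {S′} links) ,
        ≤-trans size′ (+-monoʳ-≤ k size)

  -- Decidability

  -- Peel off the last move: First-Fit fixes its colour, so only its two ends are searched, and the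
  -- condition on the final graph becomes `R′` on the graph before.
  any-play? : ∀ {n} t {R : ColouredGraph n → Set} → (∀ G → Dec (R G)) →
              Dec (∃[ G ] FirstFitPlay G × length G ≡ t × R G)
  any-play? zero R? = map′ (λ r → [] , start , refl , r) (λ { ([] , _ , _ , r) → r }) (R? [])
  any-play? {n} (suc t) {R} R? = map′ to from (any-play? t R′?)
    where
    R′ : ColouredGraph n → Set
    R′ G = ∃[ u ] ∃[ v ] u ≢ v × ¬ Adjacent G u v × R ((u , v , proj₁ (least-available G u v)) ∷ G)

    R′? : ∀ G → Dec (R′ G)
    R′? G = Fin.any? λ u → Fin.any? λ v → ¬? (u Fin.≟ v) ×-dec (¬? (Adjacent? G u v) ×-dec R? _)

    to : (∃[ G ] FirstFitPlay G × length G ≡ t × R′ G) → ∃[ G ] FirstFitPlay G × length G ≡ suc t × R G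
    to (G , play , refl , u , v , u≢v , nonadj , r) =
      _ , present play u≢v nonadj (proj₂ (least-available G u v)) , refl , r

    from : (∃[ G ] FirstFitPlay G × length G ≡ suc t × R G) → ∃[ G ] FirstFitPlay G × length G ≡ t × R′ G
    from (_ , present {G} {u} {v} play u≢v nonadj c-least , refl , r) =
      G , play , refl , u , v , u≢v , nonadj ,
      -- Uniqueness of the least colour identifies the one played with the one computed.
      subst (λ c → R ((u , v , c) ∷ G)) (least-unique c-least (proj₂ (least-available G u v))) r

  -- The search reaches every function only up to pointwise equality, so `Q` has to respect it.
  any-function? : ∀ m {n} {Q : (Fin m → Fin n) → Set} → (∀ {f g} → f ≗ g → Q f → Q g) →
                  (∀ f → Dec (Q f)) → Dec (∃ Q)
  any-function? zero {Q = Q} respects Q? = map′ (λ q → _ , q) (λ (f , q) → respects (λ ()) q) (Q? (λ ()))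
  any-function? (suc m) {Q = Q} respects Q? =
    map′ (λ (x , f , q) → x Vector.∷ f , q)
         (λ (f , q) → f zero , f ∘ fsuc , respects (λ { zero → refl ; (fsuc _) → refl }) q)
         (Fin.any? λ x → any-function? m (λ f≗g → respects (λ { zero → refl ; (fsuc i) → f≗g i }))
           (λ f → Q? (x Vector.∷ f)))

  module _ (H : Graph) {n : ℕ} (G : ColouredGraph n) where
    open Graph H

    IsCopy? : ∀ f → Dec (IsCopy H G f)
    IsCopy? f = map′ (λ inj {i} {j} → inj i j) (λ inj i j → inj {i} {j})
                     (Fin.all? λ i → Fin.all? λ j → (f i Fin.≟ f j) →-dec (i Fin.≟ j))
                ×-dec (Fin.all? λ i → Fin.all? λ j → (i ~? j) →-dec Adjacent? G (f i) (f j))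

    -- A colour found on an edge is at most `maxColour G`, which bounds the quantifier over colours.
    IsRainbow? : ∀ f → Dec (IsRainbow H G f)
    IsRainbow? f = Fin.all? λ i → Fin.all? λ j → Fin.all? λ i′ → Fin.all? λ j′ →
      map′ (λ h c p q e e′ → h (s≤s (HasEdge⇒≤maxColour e)) p q e e′) (λ h {c} _ → h c)
           (allUpTo? (λ c → (i ~? j) →-dec ((i′ ~? j′) →-dec (HasEdge? G (f i) (f j) c →-dec
                            (HasEdge? G (f i′) (f j′) c →-dec
                            (((i Fin.≟ i′) ×-dec (j Fin.≟ j′)) ⊎-dec ((i Fin.≟ j′) ×-dec (j Fin.≟ i′)))))))
                     (suc (maxColour G)))

    HasRainbowCopy? : Dec (HasRainbowCopy H G)
    HasRainbowCopy? = any-function? order respects (λ f → IsCopy? f ×-dec IsRainbow? f)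
      where
      respects : ∀ {f g} → f ≗ g → IsCopy H G f × IsRainbow H G f → IsCopy H G g × IsRainbow H G g
      respects eq ((inj , adj) , rainbow) =
        ( (λ {i} {j} p → inj (trans (eq i) (trans p (sym (eq j)))))
        , (λ i j p → subst₂ (Adjacent G) (eq i) (eq j) (adj i j p)))
        , λ i j i′ j′ c p q e e′ → rainbow i j i′ j′ c p q
            (subst₂ (λ u v → HasEdge G u v c) (sym (eq i)) (sym (eq j)) e)
            (subst₂ (λ u v → HasEdge G u v c) (sym (eq i′)) (sym (eq j′)) e′)

  -- Renaming the vertices of a play

  module Relabel {n m : ℕ} (g : Fin n → Fin m) (V : Fin n → Set)
                 (injective-on : ∀ {x y} → V x → V y → g x ≡ g y → x ≡ y) where

    relabel : ColouredGraph n → ColouredGraph m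
    relabel = map (λ (u , v , c) → g u , g v , c)

    Covers : ColouredGraph n → Set
    Covers G = ∀ {u v c} → HasEdge G u v c → V u

    ∈-relabel⁺ : ∀ {G u v c} → HasEdge G u v c → HasEdge (relabel G) (g u) (g v) c
    ∈-relabel⁺ = Sum.map (∈-map⁺ _) (∈-map⁺ _)

    -- `covers` puts the original end of the edge into `V`, where `g` is injective, so an edge at
    -- `g u` comes from an edge at `u`.
    ∈-relabel⁻ : ∀ {G u y c} → Covers G → V u → HasEdge (relabel G) (g u) y c →
                 ∃[ v ] y ≡ g v × HasEdge G u v c
    ∈-relabel⁻ covers Vu (inj₁ e) with (u′ , v′ , _) , e′ , eq ← ∈-map⁻ _ e
      with refl ← injective-on Vu (covers (inj₁ e′)) (cong proj₁ eq)
      with refl ← cong (proj₁ ∘ proj₂) eq | refl ← cong (proj₂ ∘ proj₂) eq = v′ , refl , inj₁ e′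
    ∈-relabel⁻ covers Vu (inj₂ e) with (v′ , u′ , _) , e′ , eq ← ∈-map⁻ _ e
      with refl ← injective-on Vu (covers (inj₂ e′)) (cong (proj₁ ∘ proj₂) eq)
      with refl ← cong proj₁ eq | refl ← cong (proj₂ ∘ proj₂) eq = v′ , refl , inj₂ e′

    HasEdge⁻ : ∀ {G u v c} → Covers G → V u → V v → HasEdge (relabel G) (g u) (g v) c → HasEdge G u v c
    HasEdge⁻ covers Vu Vv e with v′ , eq , e′ ← ∈-relabel⁻ covers Vu e
      with refl ← injective-on Vv (covers (HasEdge-sym e′)) eq = e′

    ColourAt⁺ : ∀ {G w c} → ColourAt G w c → ColourAt (relabel G) (g w) c
    ColourAt⁺ (x , e) = g x , ∈-relabel⁺ e

    ColourAt⁻ : ∀ {G w c} → Covers G → V w → ColourAt (relabel G) (g w) c → ColourAt G w c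
    ColourAt⁻ covers Vw (_ , e) with v , _ , e′ ← ∈-relabel⁻ covers Vw e = v , e′

    -- Renaming keeps the colours at both ends, so the same colour stays least available.
    play⁺ : ∀ {G} → Covers G → FirstFitPlay G → FirstFitPlay (relabel G)
    play⁺ covers start = start
    play⁺ covers (present {G} {u} {v} {c} play u≢v nonadj ((1≤c , ¬u , ¬v) , minimal)) =
      present (play⁺ covers′ play) (u≢v ∘ injective-on Vu Vv)
        (λ (c′ , e) → nonadj (c′ , HasEdge⁻ covers′ Vu Vv e))
        ((1≤c , ¬u ∘ ColourAt⁻ covers′ Vu , ¬v ∘ ColourAt⁻ covers′ Vv) ,
         λ c′ (1≤c′ , ¬u′ , ¬v′) → minimal c′ (1≤c′ , ¬u′ ∘ ColourAt⁺ , ¬v′ ∘ ColourAt⁺))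
      where
      covers′ : Covers G
      covers′ e = covers (HasEdge-∷ e)
      Vu : V u
      Vu = covers (inj₁ (here refl))
      Vv : V v
      Vv = covers (inj₂ (here refl))

    copy⁺ : ∀ {H G} → Covers G → (copy : HasRainbowCopy H G) → (∀ i → V (proj₁ copy i)) →
            HasRainbowCopy H (relabel G)
    copy⁺ covers (f , (inj , adj) , rainbow) Vf = g ∘ f ,
      ( (λ {i} {j} eq → inj (injective-on (Vf i) (Vf j) eq))
      , (λ i j p → let c , e = adj i j p in c , ∈-relabel⁺ e)) ,
      λ i j i′ j′ c p q e e′ → rainbow i j i′ j′ c p q
        (HasEdge⁻ covers (Vf i) (Vf j) e) (HasEdge⁻ covers (Vf i′) (Vf j′) e′)

  module _ {n : ℕ} where

    endpoints : ColouredGraph n → List (Fin n)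
    endpoints [] = []
    endpoints ((u , v , _) ∷ G) = u ∷ v ∷ endpoints G

    length-endpoints : ∀ G → length (endpoints G) ≡ length G * 2
    length-endpoints [] = refl
    length-endpoints (_ ∷ G) = cong (2 +_) (length-endpoints G)

    ∈-endpoints : ∀ {G : ColouredGraph n} {u v c} → HasEdge G u v c → u ∈ endpoints G
    ∈-endpoints {_ ∷ _} (inj₁ (here refl)) = here refl
    ∈-endpoints {_ ∷ _} (inj₂ (here refl)) = there (here refl)
    ∈-endpoints {_ ∷ _} (inj₁ (there e))   = there (there (∈-endpoints (inj₁ e)))
    ∈-endpoints {_ ∷ _} (inj₂ (there e))   = there (there (∈-endpoints (inj₂ e)))

    -- The default value zero is used only off the list.
    position : (xs : List (Fin n)) → Fin n → Fin (suc (length xs))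
    position xs x with any? (x Fin.≟_) xs
    ... | yes x∈ = fsuc (index x∈)
    ... | no _   = zero

    position-injective : ∀ {xs x y} → x ∈ xs → y ∈ xs → position xs x ≡ position xs y → x ≡ y
    position-injective {xs} {x} {y} x∈ y∈ eq with any? (x Fin.≟_) xs | any? (y Fin.≟_) xs
    ... | yes p | yes q = trans (lookup-index p)
        (trans (cong (lookup xs) (Fin.suc-injective eq)) (sym (lookup-index q)))
    ... | no ¬p | _     = ⊥-elim (¬p x∈)
    ... | _     | no ¬q = ⊥-elim (¬q y∈)

  -- A path with an edge has no isolated vertex, so its copy lies among the at most `2t` ends of the
  -- presented edges; the extra place is the default of `position`.
  Forces-bounded : ∀ {k t} → Forces (path (suc k)) t →
                   Σ (ColouredGraph (suc (t * 2))) λ G →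
                     FirstFitPlay G × length G ≡ t × HasRainbowCopy (path (suc k)) G
  Forces-bounded {k} (n , G , play , refl , copy@(f , (_ , adj) , _)) =
    subst (λ m → Σ (ColouredGraph (suc m)) λ G′ →
      FirstFitPlay G′ × length G′ ≡ length G × HasRainbowCopy (path (suc k)) G′)
      (length-endpoints G)
      (relabel G , play⁺ ∈-endpoints play , length-map _ G , copy⁺ {path (suc k)} ∈-endpoints copy on-path)
    where
    open Relabel (position (endpoints G)) (_∈ endpoints G) (position-injective {xs = endpoints G})
    on-path : ∀ i → f i ∈ endpoints G
    on-path zero = ∈-endpoints (proj₂ (adj zero (fsuc zero) (inj₁ refl)))
    on-path (fsuc i) = ∈-endpoints
      (proj₂ (adj (fsuc i) (inject₁ i) (inj₂ (cong suc (sym (Fin.toℕ-inject₁ i))))))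

  Forces? : ∀ k t → Dec (Forces (path (suc k)) t)
  Forces? k t = map′ (λ F → suc (t * 2) , F) Forces-bounded (any-play? t (HasRainbowCopy? (path (suc k))))

  -- Asymptotics

  open import Data.Integer using (+_)

  First-Fit-number : ∀ k → ∃[ t ] IsAR-FF (path (suc k)) t ×
    suc k ^ 2 ≤ 8 * t × 8 * t ≤ suc k ^ 2 + 202 * suc k
  First-Fit-number k′ = t , is-least , lower , upper
    where
    k = suc k′
    q = k ℕ./ 4
    r = k % 4

    -- `B = 2 + q` is large enough because `k ≤ 4q + 3`.
    room : ∀ {k q r} → k ≡ r + q * 4 → r < 4 → k + 2 ≤ 4 * (2 + q)
    room {k} {q} {r} e h = by-≤ 3 (≡⇒≤ e ⊕ h) (solve (k ∷ q ∷ r ∷ []))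

    division : k ≡ r + q * 4
    division = m≡m%n+[m/n]*n k 4

    built : ∃[ t ] Forces (path k) t × t ≤ k + (3 + q) * (2 * (3 + q) + 1)
    built = Build.forced (2 + q) k (room division (m%n<n k 4))

    least-forced : ∃ (IsLeast (Forces (path k)))
    least-forced = least (Forces? k′) (proj₁ built) (proj₁ (proj₂ built))

    t : ℕ
    t = proj₁ least-forced
    is-least : IsAR-FF (path k) t
    is-least = proj₂ least-forced

    square≤ : ∀ k → k ^ 2 ≤ k * suc k
    square≤ k = *-monoʳ-≤ k (≤-trans (≤-reflexive (*-identityʳ k)) (n≤1+n k))

    lower : k ^ 2 ≤ 8 * t
    lower = ≤-trans (square≤ k) (lower-bound {k} (proj₁ is-least))

    -- `202 = 8 + 26 + 168` collects the lower-order terms after bounding `4q` and 1 by `k`.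
    estimate : ∀ {k q r} → k ≡ r + q * 4 → 1 ≤ k → 8 * (k + (3 + q) * (2 * (3 + q) + 1)) ≤ k * k + 202 * k
    estimate {k} {q} {r} e 1≤k = begin
      8 * (k + (3 + q) * (2 * (3 + q) + 1))      ≡⟨ expand ⟩
      q * 4 * (q * 4) + 8 * k + 26 * (q * 4) + 168 * 1
        ≤⟨ +-mono-≤ (+-mono-≤ (+-monoˡ-≤ (8 * k) (*-mono-≤ 4q≤k 4q≤k)) (*-monoʳ-≤ 26 4q≤k))
          (*-monoʳ-≤ 168 1≤k) ⟩
      k * k + 8 * k + 26 * k + 168 * k           ≡⟨ collect ⟩
      k * k + 202 * k                            ∎
      where
      open ≤-Reasoning
      4q≤k : q * 4 ≤ k
      4q≤k = ≤-trans (m≤n+m (q * 4) r) (≤-reflexive (sym e))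
      expand : 8 * (k + (3 + q) * (2 * (3 + q) + 1)) ≡ q * 4 * (q * 4) + 8 * k + 26 * (q * 4) + 168 * 1
      expand = solve (k ∷ q ∷ [])
      collect : k * k + 8 * k + 26 * k + 168 * k ≡ k * k + 202 * k
      collect = solve (k ∷ [])

    upper : 8 * t ≤ k ^ 2 + 202 * k
    upper = ≤-trans (*-monoʳ-≤ 8 (≤-trans (proj₂ is-least _ (proj₁ (proj₂ built))) (proj₂ (proj₂ built))))
      (≤-trans (estimate {k} {q} {r} division (s≤s z≤n))
        (≤-reflexive (cong (λ m → k * m + 202 * k) (sym (*-identityʳ k)))))

  /-≃ : ∀ m d → toℚᵘ ((+ m) /ℚ suc d) ≃ mkℚᵘ (+ m) d
  /-≃ m d = ℚ.toℚᵘ-fromℚᵘ (mkℚᵘ (+ m) d)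

  -- This is `t = (D / 8)(1 + e / D)` with `D = suc d`, in the shape to which unnormalised fractions
  -- compute; over the naturals it is `8tD = (D + e)D`.
  cross-multiplied : ∀ {t d e} → 8 * t ≡ suc d + e →
    (+ t) ℤ.* (+ (8 * (1 * suc d))) ≡ (+ suc d) ℤ.* ((+ 1) ℤ.* (+ suc d) ℤ.+ (+ e) ℤ.* (+ 1)) ℤ.* (+ 1)
  cross-multiplied {t} {d} {e} eq = begin
    (+ t) ℤ.* (+ (8 * (1 * suc d)))             ≡⟨ ℤ.pos-* t _ ⟨
    + (t * (8 * (1 * suc d)))                   ≡⟨ cong +_ (naturals {t} {suc d} eq) ⟩
    + (suc d * (1 * suc d + e * 1) * 1)         ≡⟨ ℤ.pos-* (suc d * (1 * suc d + e * 1)) 1 ⟩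
    + (suc d * (1 * suc d + e * 1)) ℤ.* (+ 1)   ≡⟨ cong (ℤ._* (+ 1)) (ℤ.pos-* (suc d) (1 * suc d + e * 1)) ⟩
    (+ suc d) ℤ.* (+ (1 * suc d + e * 1)) ℤ.* (+ 1)
      ≡⟨ cong (λ x → (+ suc d) ℤ.* x ℤ.* (+ 1))
        (trans (ℤ.pos-+ (1 * suc d) (e * 1)) (cong₂ ℤ._+_ (ℤ.pos-* 1 (suc d)) (ℤ.pos-* e 1))) ⟩
    (+ suc d) ℤ.* ((+ 1) ℤ.* (+ suc d) ℤ.+ (+ e) ℤ.* (+ 1)) ℤ.* (+ 1) ∎
    where
    open ≡-Reasoning
    naturals : ∀ {t D e} → 8 * t ≡ D + e → t * (8 * (1 * D)) ≡ D * (1 * D + e * 1) * 1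
    naturals {t} {D} {e} eq = trans (left t D) (trans (cong (_* D) eq) (right D e))
      where
      left : ∀ t D → t * (8 * (1 * D)) ≡ 8 * t * D
      left t D = solve (t ∷ D ∷ [])
      right : ∀ D e → (D + e) * D ≡ D * (1 * D + e * 1) * 1
      right D e = solve (D ∷ e ∷ [])

  rescale : ∀ {t d e} → 8 * t ≡ suc d + e → (+ t) /ℚ 1 ≡ ((+ suc d) /ℚ 8) *ℚ (1ℚ +ℚ ((+ e) /ℚ suc d))
  rescale {t} {d} {e} eq = ℚ.toℚᵘ-injective (begin
    toℚᵘ ((+ t) /ℚ 1)                                       ≈⟨ /-≃ t 0 ⟩
    mkℚᵘ (+ t) 0                                            ≈⟨ *≡* (cross-multiplied {t} {d} eq) ⟩
    mkℚᵘ (+ suc d) 7 ℚᵘ.* (ℚᵘ.1ℚᵘ ℚᵘ.+ mkℚᵘ (+ e) d)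
      ≈⟨ ℚᵘ.*-cong (ℚᵘ.≃-sym (/-≃ (suc d) 7))
        (ℚᵘ.≃-sym (ℚᵘ.≃-trans (ℚ.toℚᵘ-homo-+ 1ℚ ((+ e) /ℚ suc d)) (ℚᵘ.+-cong ℚᵘ.≃-refl (/-≃ e d)))) ⟩
    toℚᵘ ((+ suc d) /ℚ 8) ℚᵘ.* toℚᵘ (1ℚ +ℚ ((+ e) /ℚ suc d))
      ≈⟨ ℚᵘ.≃-sym (ℚ.toℚᵘ-homo-* ((+ suc d) /ℚ 8) (1ℚ +ℚ ((+ e) /ℚ suc d))) ⟩
    toℚᵘ (((+ suc d) /ℚ 8) *ℚ (1ℚ +ℚ ((+ e) /ℚ suc d)))      ∎)
    where open import Relation.Binary.Reasoning.Setoid ℚᵘ.≃-setoid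

  -- A positive `ε` has numerator at least one, so it is at least the reciprocal of its denominator.
  fraction-< : ∀ {m d ε} → 0ℚ <ℚ ε → m * ↧ₙ ε < suc d → ∣ (+ m) /ℚ suc d ∣ℚ <ℚ ε
  fraction-< {m} {d} {mkℚ (+ zero) _ _} (ℚ.*<* (ℤ.+<+ ())) _
  fraction-< {m} {d} {mkℚ ℤ.-[1+ _ ] _ _} (ℚ.*<* ()) _
  fraction-< {m} {d} {ε@(mkℚ (+ suc a) b _)} _ h =
    subst (_<ℚ ε) (sym (ℚ.0≤p⇒∣p∣≡p (ℚ.nonNegative⁻¹ _ ⦃ ℚ.normalize-nonNeg m (suc d) ⦄)))
      (ℚ.toℚᵘ-cancel-< (ℚᵘ.<-respˡ-≃ (ℚᵘ.≃-sym (/-≃ m d))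
        (*<* (subst₂ ℤ._<_ (ℤ.pos-* m (suc b)) (ℤ.pos-* (suc a) (suc d))
        (ℤ.+<+ (<-≤-trans h (m≤m+n (suc d) (a * suc d))))))))

  module Asymptotics (a : ℕ → ℕ) (C : ℕ)
    (lower : ∀ k → suc k ^ 2 ≤ a k)
    (upper : ∀ k → a k ≤ suc k ^ 2 + C * suc k) where

    -- Obtained by solving the claimed equation for the error term, so that the equation is exact
    -- and only the limit takes an estimate.
    relative-error : ℕ → ℚ
    -- A default value, as the formula would divide by zero.
    relative-error zero    = 0ℚ
    relative-error (suc k) = (+ (a k ∸ suc k ^ 2)) /ℚ (suc k ^ 2)

    -- By `upper` the error at `k` is at most `C / k`, which drops below the reciprocal of the
    -- denominator of `ε`.
    relative-error→0 : TendsToZero relative-error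
    relative-error→0 ε 0<ε = suc (C * ↧ₙ ε) , small
      where
      small : ∀ k → C * ↧ₙ ε < k → ∣ relative-error k ∣ℚ <ℚ ε
      small (suc k) large = fraction-< {a k ∸ suc k ^ 2} {pred (suc k ^ 2)} 0<ε (begin-strict
        (a k ∸ suc k ^ 2) * ↧ₙ ε ≤⟨ *-monoˡ-≤ (↧ₙ ε) (m≤n+o⇒m∸n≤o (a k) (suc k ^ 2) (upper k)) ⟩
        C * suc k * ↧ₙ ε         ≡⟨ swap C (suc k) (↧ₙ ε) ⟩
        C * ↧ₙ ε * suc k         <⟨ *-monoˡ-< (suc k) large ⟩
        suc k * suc k            ≡⟨ cong (suc k *_) (*-identityʳ (suc k)) ⟨
        suc k ^ 2                ∎)
        where
        open ≤-Reasoning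
        swap : ∀ C a b → C * a * b ≡ C * b * a
        swap C a b = solve (C ∷ a ∷ b ∷ [])

    exact : ∀ {k t} → 8 * t ≡ a k → (+ t) /ℚ 1 ≡ ((+ (suc k ^ 2)) /ℚ 8) *ℚ (1ℚ +ℚ relative-error (suc k))
    exact {k} {t} eq = rescale {t} {pred (suc k ^ 2)} {a k ∸ suc k ^ 2}
      (trans eq (sym (m+[n∸m]≡n (lower k))))

  open Asymptotics (λ k → 8 * proj₁ (First-Fit-number k)) 202
    (λ k → proj₁ (proj₂ (proj₂ (First-Fit-number k))))
    (λ k → proj₂ (proj₂ (proj₂ (First-Fit-number k)))) public

open import Data.Integer using (+_)
open import Data.Rational using (1ℚ; _/_; _+_; _*_)

theorem13 : Σ (ℕ → ℚ) λ o → TendsToZero o ×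
    (∀ (k : ℕ) → 1 ≤ k →
      Σ ℕ λ t → IsAR-FF (path k) t ×
                (+ t) / 1 ≡ ((+ (k ^ 2)) / 8) * (1ℚ + o k))
theorem13 = relative-error , relative-error→0 ,
  λ { (suc k) _ → let t , is-least , _ = First-Fit-number k in t , is-least , exact {k} {t} refl }
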